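{- For all integers $n,k\geqslant 1$, $$(-1)^k \bigg(\overline{p}(n)+2\sum_{j=1}^k (-1)^{j}\,\overline{p}(n-j^2) \bigg)\geqslant 0,$$ with strict inequality if $n\geqslant (k+1)^2$. For example, for all $n\geqslant 1$, $$\overline{p}(n)-2\overline{p}(n-1)\leqslant 0,$$ $$\overline{p}(n)-2\overline{p}(n-1)+2\overline{p}(n-4)\geqslant 0,$$ $$\overline{p}(n)-2\overline{p}(n-1)+2\overline{p}(n-4)-2\overline{p}(n-9)\leqslant 0.$$
   Context: The overpartition function $\overline{p}(n)$, for $n\geqslant 1$, denotes the number of ways of writing the integer $n$ as a sum of positive integers in non-increasing order in which the first occurrence of an integer may be overlined or not; $\overline{p}(0)=1$, and $\overline{p}(m)=0$ for all negative integers $m$. Equivalently, $\sum_{n=0}^{\infty}\overline{p}(n) q^n=\prod_{n=1}^\infty \frac{1+q^n}{1-q^n}=1+2q+4q^2+8q^3+14q^4+\cdots$. -}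

module Defs where

open import Data.Bool using (Bool; true; false; T)
open import Data.Bool.Properties using (T?)
open import Data.Integer as ℤ using (ℤ; +_; -[1+_]; 0ℤ)
open import Data.List using (List; []; _∷_; [_]; map; sum; length; filter; upTo; cartesianProduct; cartesianProductWith)
open import Data.List.Membership.Propositional using (_∈_)
open import Data.List.Membership.Propositional.Properties
  using (∈-filter⁺; ∈-filter⁻; ∈-map⁺; ∈-upTo⁺; ∈-cartesianProduct⁺; ∈-cartesianProductWith⁺; ∈-cartesianProductWith⁻)
open import Data.List.Properties using (∷-injective)
open import Data.List.Relation.Unary.All as All using (All; []; _∷_)
open import Data.List.Relation.Unary.AllPairs as AllPairs using (AllPairs; []; _∷_)
open import Data.List.Relation.Unary.Any using (here; there)
open import Data.List.Relation.Unary.Linked as Linked using (Linked)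
open import Data.List.Relation.Unary.Unique.Propositional using (Unique)
import Data.List.Relation.Unary.Unique.Propositional.Properties as Unique
open import Data.Nat using (ℕ; zero; suc; _≤_; _≥_; z≤n; s≤s; _≟_; _≤?_; _≥?_)
open import Data.Nat.Properties using (suc-injective; ≤-trans; +-mono-≤; m≤m+n; m≤n+m)
open import Data.Product using (_×_; _,_; proj₁; proj₂)
open import Function using (_⇔_; mk⇔)
open import Relation.Binary.PropositionalEquality using (_≡_; _≢_; refl)
open import Relation.Nullary using (Dec; ¬?; _×-dec_; _→-dec_; map′)

record Part : Set where
  constructor part
  field
    size      : ℕ
    overlined : Bool

open Part public

record IsOverpartition (n : ℕ) (ps : List Part) : Set where
  constructor isOverpartition
  field
    positive      : All (λ p → 1 ≤ size p) ps
    nonIncreasing : Linked _≥_ (map size ps)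
    -- AllPairs relates each entry p to every later entry q: an overlined q
    -- has no earlier entry of the same size.
    firstOnly     : AllPairs (λ p q → T (overlined q) → size p ≢ size q) ps
    total         : sum (map size ps) ≡ n

isOverpartition? : ∀ n ps → Dec (IsOverpartition n ps)
isOverpartition? n ps =
  map′ (λ (a , b , c , d) → isOverpartition a b c d)
       (λ (isOverpartition a b c d) → a , b , c , d)
       (All.all? (λ p → 1 ≤? size p) ps
        ×-dec Linked.linked? _≥?_ (map size ps)
        ×-dec AllPairs.allPairs? (λ p q → T? (overlined q) →-dec ¬? (size p ≟ size q)) ps
        ×-dec (sum (map size ps) ≟ n))

partsUpTo : ℕ → List Part
partsUpTo n = cartesianProductWith part (map suc (upTo n)) (false ∷ true ∷ [])

-- All lists of length at most l with entries from xs.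
listsUpTo : ∀ {A : Set} → ℕ → List A → List (List A)
listsUpTo zero    xs = [ [] ]
listsUpTo (suc l) xs = [] ∷ cartesianProductWith _∷_ xs (listsUpTo l xs)

-- An overpartition of n has at most n parts, each of size at most n, so
-- this list is exhaustive; see overpartitions-complete and overpartitions-unique.
overpartitions : ℕ → List (List Part)
overpartitions n = filter (isOverpartition? n) (listsUpTo n (partsUpTo n))

p̄ : ℤ → ℤ
p̄ (+ n)    = + length (overpartitions n)
p̄ -[1+ _ ] = 0ℤ

-- ∑₁ k f = f 1 + ⋯ + f k
∑₁ : ℕ → (ℕ → ℤ) → ℤ
∑₁ zero    f = 0ℤ
∑₁ (suc k) f = ∑₁ k f ℤ.+ f (suc k)

∈-listsUpTo : ∀ {A : Set} {xs : List A} l {ys} → length ys ≤ l → All (_∈ xs) ys → ys ∈ listsUpTo l xs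
∈-listsUpTo zero    {[]}     _       _        = here refl
∈-listsUpTo (suc l) {[]}     _       _        = here refl
∈-listsUpTo (suc l) {y ∷ ys} (s≤s b) (y∈ ∷ a) = there (∈-cartesianProductWith⁺ _∷_ y∈ (∈-listsUpTo l b a))

∈-partsUpTo : ∀ {n} p → 1 ≤ size p → size p ≤ n → p ∈ partsUpTo n
∈-partsUpTo (part (suc s) o) _ s<n = ∈-cartesianProductWith⁺ part (∈-map⁺ suc (∈-upTo⁺ s<n)) (bool o)
  where
  bool : ∀ b → b ∈ false ∷ true ∷ []
  bool false = here refl
  bool true  = there (here refl)

length≤sum : ∀ {ps} → All (λ p → 1 ≤ size p) ps → length ps ≤ sum (map size ps)
length≤sum []      = z≤n
length≤sum (h ∷ a) = +-mono-≤ h (length≤sum a)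

sizes≤sum : ∀ ps → All (λ p → size p ≤ sum (map size ps)) ps
sizes≤sum []       = []
sizes≤sum (p ∷ ps) = m≤m+n _ _ ∷ All.map (λ h → ≤-trans h (m≤n+m _ _)) (sizes≤sum ps)

overpartitions-complete : ∀ n ps → ps ∈ overpartitions n ⇔ IsOverpartition n ps
overpartitions-complete n ps = mk⇔
  (λ m → proj₂ (∈-filter⁻ (isOverpartition? n) {xs = listsUpTo n (partsUpTo n)} m))
  (λ v → ∈-filter⁺ (isOverpartition? n) (candidate v) v)
  where
  candidate : ∀ {n} → IsOverpartition n ps → ps ∈ listsUpTo n (partsUpTo n)
  candidate (isOverpartition pos _ _ refl) =
    ∈-listsUpTo _ (length≤sum pos)
      (All.zipWith (λ (h , b) → ∈-partsUpTo _ h b) (pos , sizes≤sum ps))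

listsUpTo-unique : ∀ {A : Set} l {xs : List A} → Unique xs → Unique (listsUpTo l xs)
listsUpTo-unique zero    u = [] ∷ []
listsUpTo-unique (suc l) {xs} u =
  All.tabulate nonEmpty ∷ Unique.cartesianProductWith⁺ _∷_ ∷-injective u (listsUpTo-unique l u)
  where
  nonEmpty : ∀ {ys} → ys ∈ cartesianProductWith _∷_ xs (listsUpTo l xs) → [] ≢ ys
  nonEmpty m refl with ∈-cartesianProductWith⁻ _∷_ xs (listsUpTo l xs) m
  ... | _ , _ , _ , _ , ()

overpartitions-unique : ∀ n → Unique (overpartitions n)
overpartitions-unique n = Unique.filter⁺ (isOverpartition? n) (listsUpTo-unique n
  (Unique.cartesianProductWith⁺ part (λ { refl → refl , refl })
    (Unique.map⁺ suc-injective (Unique.upTo⁺ n))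
    (((λ ()) ∷ []) ∷ [] ∷ [])))

p̄-values : map (λ n → p̄ (+ n)) (upTo 4) ≡ + 1 ∷ + 2 ∷ + 4 ∷ + 8 ∷ []
p̄-values = refl

{-# OPTIONS --safe #-}

-- Put P_m = ∏_{i ≤ m} (1 + q^i) / (1 − q^i) and P = P_∞, the generating function of p̄. The idea is to
-- write (−1)^k (P (1 + 2 ∑_{j=1}^k (−1)^j q^{j²}) − 1) as the series
--   W_k = 2 P_k ∑_{m ≥ 0} P_m q^{(k+1)(m+k+1)} / (1 − q^{m+k+1}),
-- whose coefficients are visibly nonnegative; its term m = 0 contains q^{(k+1)²}, and for k ≥ 1 all
-- coefficients of P_k are positive, which gives strictness from (k+1)² on. The formula follows by induction
-- on k from W_0 = P − 1, where the sum telescopes, and W_{k+1} + W_k = 2 q^{(k+1)²} P. For the latter, write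
-- z = q^{k+1}; then the relation (1 − q^m) P_m = (1 + q^m) P_{m−1} combines the terms of the two sums into
-- those of (1 − z²) z^{k+1} ∑ P_m z^m, while it also shows that P_k (1 + z) ∑ P_m z^m = P for every k.
-- To keep all sums finite and identities exact, only the ring ℤ[[q]] / (q^N) with N large is used.
module Submission where

open import Defs
open import Algebra.Bundles using (CommutativeRing)
import Algebra.Properties.CommutativeSemiring.Exp
import Algebra.Properties.Ring
import Algebra.Properties.Semiring.Exp
import Algebra.Properties.Semiring.Mult.TCOptimised
import Algebra.Solver.Ring
open import Algebra.Solver.Ring.AlmostCommutativeRing using (fromCommutativeRing; _-Raw-AlmostCommutative⟶_)
open import Data.Bool using (true; false; T)
open import Data.Empty using (⊥-elim)
import Data.Integer as ℤ
import Data.Integer.Properties as ℤ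
open import Data.Integer.Solver using (module +-*-Solver)
open import Data.List using (List; []; _∷_; _++_; map; length)
open import Data.List.Membership.Propositional using (_∈_)
open import Data.List.Membership.Propositional.Properties using (∈-++⁺ˡ; ∈-++⁺ʳ; ∈-++⁻; ∈-map⁺; ∈-map⁻)
open import Data.List.Membership.Propositional.Properties.WithK using (unique∧set⇒bag)
open import Data.List.Properties using (length-++; length-map; ∷-injectiveʳ)
open import Data.List.Relation.Binary.BagAndSetEquality using (∼bag⇒↭)
open import Data.List.Relation.Binary.Disjoint.Propositional using (Disjoint)
open import Data.List.Relation.Binary.Permutation.Propositional.Properties using (↭-length)
open import Data.List.Relation.Unary.All as All using (All; []; _∷_)
import Data.List.Relation.Unary.All.Properties as All
open import Data.List.Relation.Unary.AllPairs using ([]; _∷_)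
open import Data.List.Relation.Unary.Any using (here)
open import Data.List.Relation.Unary.Linked using (Linked; []; [-]; _∷_)
open import Data.List.Relation.Unary.Linked.Properties using (Linked⇒AllPairs)
open import Data.List.Relation.Unary.Unique.Propositional using (Unique)
import Data.List.Relation.Unary.Unique.Propositional.Properties as Unique
open import Data.Maybe using (just; nothing)
open import Data.Nat as ℕ using (ℕ; zero; suc; z≤n; s≤s; _≥_)
import Data.Nat.Properties as ℕ
open import Data.Product using (_×_; _,_; ∃; proj₁; proj₂)
open import Data.Sum using (inj₁; inj₂)
open import Data.Unit using (tt)
open import Function using (_∘_; mk⇔; Equivalence)
open import Level using (0ℓ)
open import Relation.Binary.Definitions using (WeaklyDecidable)
open import Relation.Binary.PropositionalEquality as ≡ using (_≡_; _≢_)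
import Relation.Binary.Reasoning.Setoid
open import Relation.Nullary using (yes; no)

-- The homomorphism from the integers to a commutative ring.

-- The coefficient map of the ring solver: cancellation needs coefficients with decidable equality.
module FromInteger {c ℓ} (R : CommutativeRing c ℓ) where

  open import Data.Integer using (ℤ; +_; -[1+_])
  open CommutativeRing R
  open Algebra.Properties.Ring ring
  open Algebra.Properties.Semiring.Mult.TCOptimised semiring renaming (_×_ to _⨯_)
  open Relation.Binary.Reasoning.Setoid setoid

  fromℤ : ℤ → Carrier
  fromℤ (+ n)    = n ⨯ 1#
  fromℤ -[1+ n ] = - (suc n ⨯ 1#)

  fromℤ-neg : ∀ i → fromℤ (ℤ.- i) ≈ - fromℤ i
  fromℤ-neg (+ zero)  = sym -0#≈0#
  fromℤ-neg (+ suc n) = refl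
  fromℤ-neg -[1+ n ]  = sym (-‿involutive _)

  fromℤ-⊖ : ∀ m n → fromℤ (m ℤ.⊖ n) ≈ m ⨯ 1# - n ⨯ 1#
  fromℤ-⊖ m       zero    = sym (trans (+-congˡ -0#≈0#) (+-identityʳ _))
  fromℤ-⊖ zero    (suc n) = sym (+-identityˡ _)
  fromℤ-⊖ (suc m) (suc n) = begin
    fromℤ (suc m ℤ.⊖ suc n)              ≈⟨ reflexive (≡.cong fromℤ (ℤ.[1+m]⊖[1+n]≡m⊖n m n)) ⟩
    fromℤ (m ℤ.⊖ n)                      ≈⟨ fromℤ-⊖ m n ⟩
    m ⨯ 1# - n ⨯ 1#                      ≈⟨ +-congʳ (xyx⁻¹≈y 1# (m ⨯ 1#)) ⟨
    (1# + m ⨯ 1# + - 1#) - n ⨯ 1#        ≈⟨ +-assoc _ _ _ ⟩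
    1# + m ⨯ 1# + (- 1# + - (n ⨯ 1#))    ≈⟨ +-congˡ (-‿+-comm 1# (n ⨯ 1#)) ⟩
    1# + m ⨯ 1# - (1# + n ⨯ 1#)          ≈⟨ +-cong (1+× m 1#) (-‿cong (1+× n 1#)) ⟨
    suc m ⨯ 1# - suc n ⨯ 1#              ∎

  fromℤ-+ : ∀ i j → fromℤ (i ℤ.+ j) ≈ fromℤ i + fromℤ j
  fromℤ-+ (+ m)    (+ n)    = ×-homo-+ 1# m n
  fromℤ-+ (+ m)    -[1+ n ] = fromℤ-⊖ m (suc n)
  fromℤ-+ -[1+ m ] (+ n)    = trans (fromℤ-⊖ n (suc m)) (+-comm _ _)
  fromℤ-+ -[1+ m ] -[1+ n ] = begin
    fromℤ (-[1+ m ] ℤ.+ -[1+ n ])        ≈⟨ reflexive (≡.cong fromℤ (ℤ.neg-distrib-+ (+ suc m) (+ suc n))) ⟨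
    - ((suc m ℕ.+ suc n) ⨯ 1#)           ≈⟨ -‿cong (×-homo-+ 1# (suc m) (suc n)) ⟩
    - (suc m ⨯ 1# + suc n ⨯ 1#)          ≈⟨ -‿+-comm _ _ ⟨
    - (suc m ⨯ 1#) - suc n ⨯ 1#          ∎

  fromℤ-*⁺ : ∀ m n → fromℤ (+ m ℤ.* + n) ≈ m ⨯ 1# * n ⨯ 1#
  fromℤ-*⁺ m n = trans (reflexive (≡.cong fromℤ (≡.sym (ℤ.pos-* m n)))) (×1-homo-* m n)

  fromℤ-*ʳ : ∀ m j → fromℤ (+ m ℤ.* j) ≈ m ⨯ 1# * fromℤ j
  fromℤ-*ʳ m (+ n)    = fromℤ-*⁺ m n
  fromℤ-*ʳ m -[1+ n ] = begin
    fromℤ (+ m ℤ.* -[1+ n ])           ≈⟨ reflexive (≡.cong fromℤ (ℤ.neg-distribʳ-* (+ m) (+ suc n))) ⟨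
    fromℤ (ℤ.- (+ m ℤ.* + suc n))      ≈⟨ fromℤ-neg (+ m ℤ.* + suc n) ⟩
    - fromℤ (+ m ℤ.* + suc n)          ≈⟨ -‿cong (fromℤ-*⁺ m (suc n)) ⟩
    - (m ⨯ 1# * suc n ⨯ 1#)            ≈⟨ -‿distribʳ-* _ _ ⟩
    m ⨯ 1# * - (suc n ⨯ 1#)            ∎

  fromℤ-* : ∀ i j → fromℤ (i ℤ.* j) ≈ fromℤ i * fromℤ j
  fromℤ-* (+ m)    j = fromℤ-*ʳ m j
  fromℤ-* -[1+ m ] j = begin
    fromℤ (-[1+ m ] ℤ.* j)             ≈⟨ reflexive (≡.cong fromℤ (ℤ.neg-distribˡ-* (+ suc m) j)) ⟨
    fromℤ (ℤ.- (+ suc m ℤ.* j))        ≈⟨ fromℤ-neg (+ suc m ℤ.* j) ⟩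
    - fromℤ (+ suc m ℤ.* j)            ≈⟨ -‿cong (fromℤ-*ʳ (suc m) j) ⟩
    - (suc m ⨯ 1# * fromℤ j)           ≈⟨ -‿distribˡ-* _ _ ⟩
    - (suc m ⨯ 1#) * fromℤ j           ∎

  fromℤ-homomorphism : ℤ.+-*-rawRing -Raw-AlmostCommutative⟶ fromCommutativeRing R
  fromℤ-homomorphism = record
    { ⟦_⟧    = fromℤ
    ; +-homo = fromℤ-+
    ; *-homo = fromℤ-*
    ; -‿homo = fromℤ-neg
    ; 0-homo = refl
    ; 1-homo = refl
    }

-- Finite sums and geometric sums in a commutative ring.

module TruncatedTheta {c ℓ} (R : CommutativeRing c ℓ) where

  open CommutativeRing R
  open Algebra.Properties.Semiring.Exp semiring
  open Algebra.Properties.CommutativeSemiring.Exp commutativeSemiring using (^-distrib-*)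
  open Algebra.Properties.Ring ring using (+-cancelʳ)
  open Relation.Binary.Reasoning.Setoid setoid
  open FromInteger R using (fromℤ; fromℤ-homomorphism)

  private
    coefficient≟ : WeaklyDecidable (λ i j → fromℤ i ≈ fromℤ j)
    coefficient≟ i j with i ℤ.≟ j
    ... | yes i≡j = just (reflexive (≡.cong fromℤ i≡j))
    ... | no  _   = nothing

  open Algebra.Solver.Ring ℤ.+-*-rawRing (fromCommutativeRing R) fromℤ-homomorphism coefficient≟
    using (solve; _:=_; _:+_; _:*_; _:-_; :-_; con)

  -- a − b = d (u − v), with both sides moved so that no subtraction occurs.
  linear : ∀ {a b u v} d → u ≈ v → a + d * v ≈ b + d * u → a ≈ b
  linear d u≈v eq = +-cancelʳ _ _ _ (trans eq (+-congˡ (*-congˡ u≈v)))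

  sum : ℕ → (ℕ → Carrier) → Carrier
  sum zero    f = 0#
  sum (suc n) f = f 0 + sum n (f ∘ suc)

  sum-cong : ∀ n {f g} → (∀ m → f m ≈ g m) → sum n f ≈ sum n g
  sum-cong zero    f≈g = refl
  sum-cong (suc n) f≈g = +-cong (f≈g 0) (sum-cong n (f≈g ∘ suc))

  sum-linear : ∀ n d f e g → sum n (λ m → d * f m + e * g m) ≈ d * sum n f + e * sum n g
  sum-linear zero    d f e g = solve 2 (λ d e → con ℤ.0ℤ := d :* con ℤ.0ℤ :+ e :* con ℤ.0ℤ) refl d e
  sum-linear (suc n) d f e g = trans (+-congˡ (sum-linear n d (f ∘ suc) e (g ∘ suc)))
    (solve 6 (λ d e x y s t → (d :* x :+ e :* y) :+ (d :* s :+ e :* t) := d :* (x :+ s) :+ e :* (y :+ t))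
       refl d e _ _ _ _)

  sum-shift : ∀ n f → sum n (f ∘ suc) + f 0 ≈ sum n f + f n
  sum-shift zero    f = refl
  sum-shift (suc n) f = begin
    (f 1 + sum n (f ∘ suc ∘ suc)) + f 0  ≈⟨ +-congʳ (trans (+-comm _ _) (sum-shift n (f ∘ suc))) ⟩
    (sum n (f ∘ suc) + f (suc n)) + f 0  ≈⟨ solve 3 (λ s x y → s :+ x :+ y := y :+ s :+ x) refl _ _ _ ⟩
    (f 0 + sum n (f ∘ suc)) + f (suc n)  ∎

  -- The sum 1 + x + ⋯ + x^(n-1) in Horner form, the recursion that `copies` follows on lists.
  geometric : ℕ → Carrier → Carrier
  geometric zero    x = 0#
  geometric (suc n) x = 1# + x * geometric n x

  geometric-suc : ∀ n x → 1# + x * geometric n x ≈ geometric n x + x ^ n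
  geometric-suc zero    x = solve 1 (λ x → con ℤ.1ℤ :+ x :* con ℤ.0ℤ := con ℤ.0ℤ :+ con ℤ.1ℤ) refl x
  geometric-suc (suc n) x = trans (+-congˡ (*-congˡ (geometric-suc n x)))
    (solve 3 (λ x g y → con ℤ.1ℤ :+ x :* (g :+ y) := (con ℤ.1ℤ :+ x :* g) :+ x :* y) refl _ _ _)

  -- Inverses and partial products for a nilpotent `q`.

  module Nilpotent (q : Carrier) (N : ℕ) (q^N≈0 : q ^ N ≈ 0#) where

    ^-vanishes : ∀ k n → (q ^ suc k) ^ (N ℕ.+ n) ≈ 0#
    ^-vanishes k n = begin
      (q ^ suc k) ^ (N ℕ.+ n)                 ≈⟨ ^-assocʳ q (suc k) (N ℕ.+ n) ⟩
      q ^ (N ℕ.+ n ℕ.+ k ℕ.* (N ℕ.+ n))       ≈⟨ ^-congʳ q (ℕ.+-assoc N n _) ⟩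
      q ^ (N ℕ.+ (n ℕ.+ k ℕ.* (N ℕ.+ n)))     ≈⟨ ^-homo-* q N _ ⟩
      q ^ N * q ^ (n ℕ.+ k ℕ.* (N ℕ.+ n))     ≈⟨ *-congʳ q^N≈0 ⟩
      0# * q ^ (n ℕ.+ k ℕ.* (N ℕ.+ n))        ≈⟨ zeroˡ _ ⟩
      0#                                      ∎

    ^N-vanishes : ∀ k → (q ^ suc k) ^ N ≈ 0#
    ^N-vanishes k = trans (^-congʳ _ (≡.sym (ℕ.+-identityʳ N))) (^-vanishes k 0)

    -- The inverse of 1 − q ^ s, for s ≥ 1, because q ^ N ≈ 0.
    inv : ℕ → Carrier
    inv s = geometric N (q ^ s)

    inv-suc : ∀ s → inv (suc s) ≈ 1# + q ^ suc s * inv (suc s)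
    inv-suc s = sym (trans (geometric-suc N (q ^ suc s)) (trans (+-congˡ (^N-vanishes s)) (+-identityʳ _)))

    -- P m = ∏_{i ≤ m} (1 + q ^ i) / (1 − q ^ i), each factor being 1 + 2 q ^ i / (1 − q ^ i).
    P : ℕ → Carrier
    P zero    = 1#
    P (suc m) = P m + q ^ suc m * (inv (suc m) * P m + inv (suc m) * P m)

    -- This is (1 - x) P_{m+1} = (1 + x) P_m for x = q^(m+1), without subtraction; it is 2 x P_m
    -- times the equation `inv-suc`.
    P-suc : ∀ m → P (suc m) ≈ q ^ suc m * P (suc m) + (P m + q ^ suc m * P m)
    P-suc m = linear (q ^ suc m * (P m + P m)) (inv-suc m)
      (solve 3 (λ x i a → (a :+ x :* (i :* a :+ i :* a)) :+ x :* (a :+ a) :* (con ℤ.1ℤ :+ x :* i)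
          := x :* (a :+ x :* (i :* a :+ i :* a)) :+ (a :+ x :* a) :+ x :* (a :+ a) :* i)
        refl (q ^ suc m) (inv (suc m)) (P m))

    -- The sums ∑ P_m z^m and their functional equation.

    h : ℕ → ℕ → Carrier
    h k m = P m * (q ^ k) ^ m

    -- For k ≥ 1 the terms from index `N` on vanish, so this is the full sum at z = q^k. At k = 0 it
    -- is a genuine partial sum.
    H : ℕ → Carrier
    H k = sum N (h k)

    h-vanishes : ∀ k → h (suc k) N ≈ 0#
    h-vanishes k = trans (*-congˡ (^N-vanishes k)) (zeroʳ _)

    -- With z = q^k, multiply `P-suc` by z^(m+1); the powers q^(m+1) z^(m+1) = (q z)^(m+1) become
    -- terms for k + 1. The factors `1#` give the right side the shape that `sum-linear` expects.
    h-suc : ∀ k m → h k (suc m) ≈ 1# * h (suc k) (suc m) + 1# * (q ^ k * h k m + q ^ suc k * h (suc k) m)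
    h-suc k m = begin
      b * (z * w) ≈⟨ linear (z * w) (P-suc m)
         (solve 6 (λ a b z w q y → b :* (z :* w) :+ (z :* w) :* ((q :* y) :* b :+ (a :+ (q :* y) :* a))
            := con ℤ.1ℤ :* (b :* ((q :* z) :* (y :* w)))
              :+ con ℤ.1ℤ :* (z :* (a :* w) :+ (q :* z) :* (a :* (y :* w)))
              :+ (z :* w) :* b) refl a b z w q (q ^ m)) ⟩
      1# * (b * ((q * z) * (q ^ m * w))) + 1# * (z * (a * w) + (q * z) * (a * (q ^ m * w)))
        ≈⟨ +-cong (*-congˡ (*-congˡ (*-congˡ qzᵐ))) (*-congˡ (+-congˡ (*-congˡ (*-congˡ qzᵐ)))) ⟨
      1# * h (suc k) (suc m) + 1# * (q ^ k * h k m + q ^ suc k * h (suc k) m) ∎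
      where
      a = P m
      b = P (suc m)
      z = q ^ k
      w = (q ^ k) ^ m
      qzᵐ : (q * z) ^ m ≈ q ^ m * w
      qzᵐ = ^-distrib-* q z m

    -- Summation of `h-suc` over m < N. The boundary term vanishes for k ≥ 1 but equals `P N` at k =
    -- 0, where it starts the induction of `P*H`.
    H-suc : ∀ k → H k + P N * (q ^ k) ^ N ≈ q ^ k * H k + (1# + q ^ suc k) * H (suc k)
    H-suc k = begin
      H k + h k N ≈⟨ sum-shift N (h k) ⟨
      -- The summand `1# * 1#` is `h k 0`, and equally `h (suc k) 0`.
      sum N (h k ∘ suc) + 1# * 1#
        ≈⟨ +-congʳ (trans (sum-cong N (h-suc k))
             (trans (sum-linear N _ _ _ _) (+-congˡ (*-congˡ (sum-linear N _ _ _ _))))) ⟩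
      (1# * s + 1# * (z * H k + q * z * H (suc k))) + 1# * 1#
        ≈⟨ linear 1# (trans (sum-shift N (h (suc k))) (+-congˡ (h-vanishes k)))
           (solve 5 (λ s z q H H′ → (con ℤ.1ℤ :* s :+ con ℤ.1ℤ :* (z :* H :+ q :* z :* H′)) :+ con ℤ.1ℤ :* con ℤ.1ℤ
               :+ con ℤ.1ℤ :* (H′ :+ con ℤ.0ℤ)
               := (z :* H :+ (con ℤ.1ℤ :+ q :* z) :* H′) :+ con ℤ.1ℤ :* (s :+ con ℤ.1ℤ :* con ℤ.1ℤ))
            refl s z q (H k) (H (suc k))) ⟩
      z * H k + (1# + q * z) * H (suc k) ∎
      where
      z = q ^ k
      s = sum N (h (suc k) ∘ suc)

    -- Here `P N` stands for the infinite product. In the induction `H-suc` replaces (1 + q^(k+2))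
    -- H_{k+2} by (1 - q^(k+1)) H_{k+1}, and the new factor turns P_{k+1} into (1 + q^(k+1)) P_k.
    P*H : ∀ k → P k * ((1# + q ^ suc k) * H (suc k)) ≈ P N
    -- As q^0 = 1, `H 0` stands on both sides of `H-suc 0` and cancels, leaving only `P N`.
    P*H zero = linear 1# (sym (trans (+-congˡ (*-congˡ (sym (^-assocʳ q 0 N)))) (H-suc 0)))
      (solve 3 (λ H Y p → con ℤ.1ℤ :* Y :+ con ℤ.1ℤ :* (H :+ p :* con ℤ.1ℤ)
          := p :+ con ℤ.1ℤ :* (con ℤ.1ℤ :* H :+ Y)) refl (H 0) _ (P N))
    P*H (suc k) = begin
      b * Y ≈⟨ linear b (sym (H-suc (suc k)))
        (solve 5 (λ b z H Y v → b :* Y :+ b :* (H :+ v) := b :* (H :- z :* H :+ v) :+ b :* (z :* H :+ Y))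
          refl b z _ Y _) ⟩
      b * (H (suc k) - z * H (suc k) + h′) ≈⟨ *-congˡ (+-congˡ (trans (*-congˡ (^N-vanishes k)) (zeroʳ _))) ⟩
      b * (H (suc k) - z * H (suc k) + 0#) ≈⟨ linear (H (suc k)) (P-suc k)
        (solve 4 (λ a b z H → b :* (H :- z :* H :+ con ℤ.0ℤ) :+ H :* (z :* b :+ (a :+ z :* a))
           := a :* ((con ℤ.1ℤ :+ z) :* H) :+ H :* b) refl (P k) b z _) ⟩
      P k * ((1# + z) * H (suc k)) ≈⟨ P*H k ⟩
      P N ∎
      where
      b = P (suc k)
      z = q ^ suc k
      Y = (1# + q ^ suc (suc k)) * H (suc (suc k))
      h′ = P N * (q ^ suc k) ^ N

    -- The series `W` and its recursion.

    t : ℕ → ℕ → Carrier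
    t k m = P m * (q ^ suc k) ^ suc (m ℕ.+ k) * inv (suc (m ℕ.+ k))

    S : ℕ → Carrier
    S k = sum N (t k)

    t-vanishes : ∀ k → t k N ≈ 0#
    t-vanishes k = begin
      P N * (z * z ^ (N ℕ.+ k)) * i  ≈⟨ *-congʳ (*-congˡ (*-congˡ (^-vanishes k k))) ⟩
      P N * (z * 0#) * i             ≈⟨ solve 3 (λ a z i → a :* (z :* con ℤ.0ℤ) :* i := con ℤ.0ℤ) refl (P N) z i ⟩
      0# ∎
      where
      z = q ^ suc k
      i = inv (suc (N ℕ.+ k))

    -- The index offset gives both terms the same denominator 1 - x z, where x = q^(m+1). By `P-suc`
    -- the combined numerator is (1 - x z)(P_{m+1} - z P_m) times a power of z, so the denominator
    -- cancels.
    t-suc : ∀ k m → let z = q ^ suc k in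
      (1# + z) * t (suc k) m + (1# - z) * t k (suc m) ≈
      z ^ suc k * h (suc k) (suc m) + (- (z ^ suc k * z * z)) * h (suc k) m
    t-suc k m = begin
      (1# + z) * t (suc k) m + (1# - z) * t k (suc m)
        ≈⟨ +-congʳ (*-congˡ (*-cong
             (*-congˡ (trans (^-congʳ (q * z) (≡.cong suc (ℕ.+-suc m k))) (^-distrib-* q z s)))
             (reflexive (≡.cong (inv ∘ suc) (ℕ.+-suc m k))))) ⟩
      (1# + z) * (a * (q ^ s * z ^ s) * i) + (1# - z) * (b * z ^ s * i)
        ≈⟨ +-cong (*-congˡ (*-congʳ (*-congˡ (*-cong (exponents q) (exponents z)))))
                  (*-congˡ (*-congʳ (*-congˡ (exponents z)))) ⟩
      (1# + z) * (a * ((x * z) * (w * v)) * i) + (1# - z) * (b * (w * v) * i)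
        -- The outer `linear` applies (1 - x z) i = 1, the inner one (1 - x) b = (1 + x) a.
        ≈⟨ linear (w * v * (b - z * a)) (trans (inv-suc (suc (m ℕ.+ k))) (+-congˡ (*-congʳ (exponents q))))
           (linear (w * v * i * z) (sym (P-suc m))
           (solve 7 (λ a b x z w₀ v i → let w = z :* w₀ in
              (((con ℤ.1ℤ :+ z) :* (a :* ((x :* z) :* (w :* v)) :* i) :+ (con ℤ.1ℤ :- z) :* (b :* (w :* v) :* i))
                :+ w :* v :* (b :- z :* a) :* (con ℤ.1ℤ :+ (x :* z) :* i))
                :+ w :* v :* i :* z :* b
              := ((v :* (b :* w) :+ (:- (v :* z :* z)) :* (a :* w₀)) :+ w :* v :* (b :- z :* a) :* i)
                :+ w :* v :* i :* z :* (x :* b :+ (a :+ x :* a))) refl a b x z (z ^ m) v i)) ⟩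
      z ^ suc k * h (suc k) (suc m) + (- (z ^ suc k * z * z)) * h (suc k) m ∎
      where
      s = suc (suc (m ℕ.+ k))
      z = q ^ suc k
      x = q ^ suc m
      w = z ^ suc m
      v = z ^ suc k
      a = P m
      b = P (suc m)
      i = inv s
      exponents : ∀ y → y ^ s ≈ y ^ suc m * y ^ suc k
      exponents y = trans (^-congʳ y (≡.cong suc (≡.sym (ℕ.+-suc m k)))) (^-homo-* y (suc m) (suc k))

    -- Summing `t-suc` leaves `t k 0` unpaired. Since (1 - z) times it is z^(k+1), it supplies
    -- exactly the missing m = 0 term of z^(k+1) H_{k+1}, and the total is z^(k+1) (1 - z²) H_{k+1}.
    S-suc : ∀ k → let z = q ^ suc k in
      (1# + z) * S (suc k) + (1# - z) * S k ≈ z ^ suc k * ((1# - z) * ((1# + z) * H (suc k)))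
    S-suc k =
      linear (1# - z) (sym (trans (sum-shift N (t k)) (trans (+-congˡ (t-vanishes k)) (+-identityʳ _))))
      (linear v (trans (sum-shift N (h (suc k))) (trans (+-congˡ (h-vanishes k)) (+-identityʳ _)))
      (linear v (inv-suc k)
      (linear 1# summed
        (solve 8 (λ z v i t s H T T′ →
           ((((con ℤ.1ℤ :+ z) :* T′ :+ (con ℤ.1ℤ :- z) :* T
            :+ (con ℤ.1ℤ :- z) :* (t :+ con ℤ.1ℤ :* v :* i))
            :+ v :* H)
            :+ v :* (con ℤ.1ℤ :+ z :* i))
            :+ con ℤ.1ℤ :* (v :* s :+ (:- (v :* z :* z)) :* H)
           := (((v :* ((con ℤ.1ℤ :- z) :* ((con ℤ.1ℤ :+ z) :* H))
            :+ (con ℤ.1ℤ :- z) :* T)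
            :+ v :* (s :+ con ℤ.1ℤ :* con ℤ.1ℤ))
            :+ v :* i)
            :+ con ℤ.1ℤ :* ((con ℤ.1ℤ :+ z) :* T′ :+ (con ℤ.1ℤ :- z) :* t))
          refl z v (inv (suc k)) (sum N (t k ∘ suc)) (sum N (h (suc k) ∘ suc)) (H (suc k)) (S k) (S (suc k))))))
      where
      z = q ^ suc k
      v = z ^ suc k
      summed : (1# + z) * S (suc k) + (1# - z) * sum N (t k ∘ suc) ≈
        v * sum N (h (suc k) ∘ suc) + (- (v * z * z)) * H (suc k)
      summed = trans (sym (sum-linear N _ _ _ _)) (trans (sum-cong N (t-suc k)) (sum-linear N _ _ _ _))

    1-z-cancelˡ : ∀ k {a b} → let z = q ^ suc k in (1# - z) * a ≈ (1# - z) * b → a ≈ b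
    1-z-cancelˡ k {a} {b} eq =
      linear (inv (suc k)) eq (linear (b - a) (inv-suc k)
        (solve 4 (λ z i a b → (a :+ i :* ((con ℤ.1ℤ :- z) :* b)) :+ (b :- a) :* (con ℤ.1ℤ :+ z :* i)
           := (b :+ i :* ((con ℤ.1ℤ :- z) :* a)) :+ (b :- a) :* i) refl (q ^ suc k) (inv (suc k)) a b))

    -- After multiplication by 1 - z, `P-suc` exposes a common factor P_k, which leaves the left
    -- side of `S-suc`; `P*H` then evaluates the right side.
    P*S-suc : ∀ k → P (suc k) * S (suc k) + P k * S k ≈ (q ^ suc k) ^ suc k * P N
    P*S-suc k = 1-z-cancelˡ k
      (linear S′ (P-suc k) (linear a (S-suc k) (linear (v * (1# - z)) (P*H k)
        (solve 8 (λ a b z v S S′ Y p →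
           ((((con ℤ.1ℤ :- z) :* (b :* S′ :+ a :* S)) :+ S′ :* (z :* b :+ (a :+ z :* a)))
              :+ a :* (v :* ((con ℤ.1ℤ :- z) :* Y)))
              :+ (v :* (con ℤ.1ℤ :- z)) :* p
            := ((((con ℤ.1ℤ :- z) :* (v :* p)) :+ S′ :* b)
              :+ a :* ((con ℤ.1ℤ :+ z) :* S′ :+ (con ℤ.1ℤ :- z) :* S))
              :+ (v :* (con ℤ.1ℤ :- z)) :* (a :* Y))
          refl a (P (suc k)) z v (S k) S′ ((1# + q ^ suc k) * H (suc k)) (P N)))))
      where
      z = q ^ suc k
      v = z ^ suc k
      a = P k
      S′ = S (suc k)

    W : ℕ → Carrier
    W k = P k * S k + P k * S k

    -- Twice `t 0 m` is P_{m+1} - P_m, so the sum over m < N telescopes to P_N - P_0.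
    W-zero : W 0 + 1# ≈ P N
    W-zero = linear 1# (sum-shift N P) (linear 1# (sym summed)
      (solve 4 (λ S s s′ p →
          ((con ℤ.1ℤ :* S :+ con ℤ.1ℤ :* S :+ con ℤ.1ℤ) :+ con ℤ.1ℤ :* (s :+ p)) :+ con ℤ.1ℤ :* s′
          := (p :+ con ℤ.1ℤ :* (s′ :+ con ℤ.1ℤ)) :+ con ℤ.1ℤ :* (con ℤ.1ℤ :* s :+ (con ℤ.1ℤ :+ con ℤ.1ℤ) :* S))
        refl (S 0) (sum N P) (sum N (P ∘ suc)) (P N)))
      where
      P-suc-t : ∀ m → P (suc m) ≈ 1# * P m + (1# + 1#) * t 0 m
      P-suc-t m rewrite ℕ.+-identityʳ m = trans
        (solve 3 (λ a x i → a :+ x :* (i :* a :+ i :* a)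
           := con ℤ.1ℤ :* a :+ (con ℤ.1ℤ :+ con ℤ.1ℤ) :* (a :* x :* i)) refl (P m) (q ^ suc m) (inv (suc m)))
        (+-congˡ (*-congˡ (*-congʳ (*-congˡ (^-congˡ (suc m) (sym (*-identityʳ q)))))))
      summed : sum N (P ∘ suc) ≈ 1# * sum N P + (1# + 1#) * S 0
      summed = trans (sum-cong N P-suc-t) (sum-linear N _ _ _ _)

    W-suc : ∀ k → W (suc k) + W k ≈ q ^ (suc k ℕ.^ 2) * P N + q ^ (suc k ℕ.^ 2) * P N
    W-suc k = begin
      (P′S′ + P′S′) + (PS + PS)  ≈⟨ solve 2 (λ x y → (x :+ x) :+ (y :+ y) := (x :+ y) :+ (x :+ y)) refl P′S′ PS ⟩
      (P′S′ + PS) + (P′S′ + PS)  ≈⟨ +-cong step step ⟩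
      q ^ (suc k ℕ.^ 2) * P N + q ^ (suc k ℕ.^ 2) * P N ∎
      where
      P′S′ = P (suc k) * S (suc k)
      PS = P k * S k
      step : P′S′ + PS ≈ q ^ (suc k ℕ.^ 2) * P N
      step = trans (P*S-suc k) (*-congʳ (trans (^-assocʳ q (suc k) (suc k))
        (^-congʳ q (≡.cong (suc k ℕ.*_) (≡.sym (ℕ.*-identityʳ (suc k)))))))

open ≡ using (refl; sym; trans; cong; cong₂; subst; module ≡-Reasoning)

-- Formal power series over the integers and their truncations.

module PowerSeries where

  open import Data.Integer using (ℤ; 0ℤ; 1ℤ; _+_; _*_; -_; _≤_)
  open +-*-Solver

  Series : Set
  Series = ℕ → ℤ

  infixl 7 _⊛_
  infixl 6 _⊕_

  _⊕_ : Series → Series → Series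
  (f ⊕ g) n = f n + g n

  ⊖_ : Series → Series
  (⊖ f) n = - f n

  0ₛ 1ₛ X : Series
  0ₛ _       = 0ℤ
  1ₛ zero    = 1ℤ
  1ₛ (suc _) = 0ℤ
  X zero     = 0ℤ
  X (suc n)  = 1ₛ n

  -- The Cauchy product, splitting off the constant coefficient of the left factor in each step.
  _⊛_ : Series → Series → Series
  (f ⊛ g) zero    = f 0 * g 0
  (f ⊛ g) (suc n) = f 0 * g (suc n) + (f ∘ suc ⊛ g) n

  -- Coefficient n of a product involves only coefficients up to n, so multiplication respects
  -- truncation.
  ⊛-cong : ∀ n {f f′ g g′} → (∀ {m} → m ℕ.≤ n → f m ≡ f′ m) → (∀ {m} → m ℕ.≤ n → g m ≡ g′ m) →
    (f ⊛ g) n ≡ (f′ ⊛ g′) n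
  ⊛-cong zero    f≡ g≡ = cong₂ _*_ (f≡ z≤n) (g≡ z≤n)
  ⊛-cong (suc n) f≡ g≡ = cong₂ _+_ (cong₂ _*_ (f≡ z≤n) (g≡ ℕ.≤-refl))
    (⊛-cong n (f≡ ∘ s≤s) (g≡ ∘ ℕ.m≤n⇒m≤1+n))

  ⊛-zeroˡ : ∀ g n → (0ₛ ⊛ g) n ≡ 0ℤ
  ⊛-zeroˡ g zero    = refl
  ⊛-zeroˡ g (suc n) = cong (_+_ 0ℤ) (⊛-zeroˡ g n)

  ⊛-identityˡ : ∀ g n → (1ₛ ⊛ g) n ≡ g n
  ⊛-identityˡ g zero    = ℤ.*-identityˡ (g 0)
  ⊛-identityˡ g (suc n) = trans (cong₂ _+_ (ℤ.*-identityˡ (g (suc n))) (⊛-zeroˡ g n)) (ℤ.+-identityʳ (g (suc n)))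

  ⊛-scaleˡ : ∀ c f g n → ((λ m → c * f m) ⊛ g) n ≡ c * (f ⊛ g) n
  ⊛-scaleˡ c f g zero    = ℤ.*-assoc c (f 0) (g 0)
  ⊛-scaleˡ c f g (suc n) = trans (cong (_+_ (c * f 0 * g (suc n))) (⊛-scaleˡ c (f ∘ suc) g n))
    (solve 4 (λ c a b s → c :* a :* b :+ c :* s := c :* (a :* b :+ s)) refl c (f 0) (g (suc n)) _)

  ⊛-distribʳ : ∀ h f g n → ((f ⊕ g) ⊛ h) n ≡ (f ⊛ h ⊕ g ⊛ h) n
  ⊛-distribʳ h f g zero    = ℤ.*-distribʳ-+ (h 0) (f 0) (g 0)
  ⊛-distribʳ h f g (suc n) = trans (cong (_+_ ((f 0 + g 0) * h (suc n))) (⊛-distribʳ h (f ∘ suc) (g ∘ suc) n))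
    (solve 5 (λ a b c s t → (a :+ b) :* c :+ (s :+ t) := (a :* c :+ s) :+ (b :* c :+ t)) refl
      (f 0) (g 0) (h (suc n)) _ _)

  -- The mirror image of the defining recursion, splitting off the constant coefficient of the right
  -- factor; commutativity rests on it.
  ⊛-sucʳ : ∀ f g n → (f ⊛ g) (suc n) ≡ f (suc n) * g 0 + (f ⊛ (g ∘ suc)) n
  ⊛-sucʳ f g zero    = ℤ.+-comm (f 0 * g 1) (f 1 * g 0)
  ⊛-sucʳ f g (suc n) = trans (cong (_+_ (f 0 * g (suc (suc n)))) (⊛-sucʳ (f ∘ suc) g n))
    (solve 3 (λ a b s → a :+ (b :+ s) := b :+ (a :+ s)) refl (f 0 * g (suc (suc n))) (f (suc (suc n)) * g 0) _)

  ⊛-comm : ∀ f g n → (f ⊛ g) n ≡ (g ⊛ f) n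
  ⊛-comm f g zero    = ℤ.*-comm (f 0) (g 0)
  ⊛-comm f g (suc n) = trans (cong₂ _+_ (ℤ.*-comm (f 0) (g (suc n))) (⊛-comm (f ∘ suc) g n)) (sym (⊛-sucʳ g f n))

  ⊛-assoc : ∀ f g h n → (f ⊛ g ⊛ h) n ≡ (f ⊛ (g ⊛ h)) n
  ⊛-assoc f g h zero    = ℤ.*-assoc (f 0) (g 0) (h 0)
  ⊛-assoc f g h (suc n) = trans
    (cong (_+_ (f 0 * g 0 * h (suc n))) (trans (⊛-distribʳ h (λ m → f 0 * g (suc m)) (f ∘ suc ⊛ g) n)
      (cong₂ _+_ (⊛-scaleˡ (f 0) (g ∘ suc) h n) (⊛-assoc (f ∘ suc) g h n))))
    (solve 5 (λ a b c s t → a :* b :* c :+ (a :* s :+ t) := a :* (b :* c :+ s) :+ t) refl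
      (f 0) (g 0) (h (suc n)) _ _)

  infix 4 _≈[_]_
  -- The quotient by q^N as a coarser equality on full series: its elements keep actual
  -- coefficients, about which signs can be stated.
  _≈[_]_ : Series → ℕ → Series → Set
  f ≈[ N ] g = ∀ n → n ℕ.< N → f n ≡ g n

  pointwise : ∀ {N f g} → (∀ n → f n ≡ g n) → f ≈[ N ] g
  pointwise f≡g n _ = f≡g n

  truncated : ℕ → CommutativeRing 0ℓ 0ℓ
  truncated N = record
    { Carrier = Series
    ; _≈_ = _≈[ N ]_
    ; _+_ = _⊕_ ; _*_ = _⊛_ ; -_ = ⊖_ ; 0# = 0ₛ ; 1# = 1ₛ
    ; isCommutativeRing = record
      { isRing = record
        { +-isAbelianGroup = record
          { isGroup = record
            { isMonoid = record
              { isSemigroup = record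
                { isMagma = record
                  { isEquivalence = record
                    { refl  = λ _ _ → refl
                    ; sym   = λ p n l → sym (p n l)
                    ; trans = λ p r n l → trans (p n l) (r n l)
                    }
                  ; ∙-cong = λ p r n l → cong₂ _+_ (p n l) (r n l)
                  }
                ; assoc = λ f g h → pointwise λ n → ℤ.+-assoc (f n) (g n) (h n)
                }
              ; identity = (λ f → pointwise λ n → ℤ.+-identityˡ (f n)) ,
                  (λ f → pointwise λ n → ℤ.+-identityʳ (f n))
              }
            ; inverse = (λ f → pointwise λ n → ℤ.+-inverseˡ (f n)) , (λ f → pointwise λ n → ℤ.+-inverseʳ (f n))
            ; ⁻¹-cong = λ p n l → cong -_ (p n l)
            }
          ; comm = λ f g → pointwise λ n → ℤ.+-comm (f n) (g n)
          }
        ; *-cong = λ p r n l → ⊛-cong n (λ {m} m≤n → p m (ℕ.≤-<-trans m≤n l)) (λ {m} m≤n → r m (ℕ.≤-<-trans m≤n l))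
        ; *-assoc = λ f g h → pointwise (⊛-assoc f g h)
        ; *-identity = (λ f → pointwise (⊛-identityˡ f)) ,
            (λ f → pointwise λ n → trans (⊛-comm f 1ₛ n) (⊛-identityˡ f n))
        ; distrib = (λ h f g → pointwise λ n → trans (⊛-comm h (f ⊕ g) n)
              (trans (⊛-distribʳ h f g n) (cong₂ _+_ (⊛-comm f h n) (⊛-comm g h n)))) ,
            (λ h f g → pointwise (⊛-distribʳ h f g))
        }
      ; *-comm = λ f g → pointwise (⊛-comm f g)
      }
    }

  X⊛-suc : ∀ f n → (X ⊛ f) (suc n) ≡ f n
  X⊛-suc f n = trans (ℤ.+-identityˡ _) (⊛-identityˡ f n)

  -- Series with nonnegative coefficients.

  NonNegative : Series → Set
  NonNegative f = ∀ n → 0ℤ ≤ f n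

  0≤* : ∀ {i j} → 0ℤ ≤ i → 0ℤ ≤ j → 0ℤ ≤ i * j
  0≤* {i} {j} 0≤i 0≤j = subst (_≤ i * j) (ℤ.*-zeroʳ i) (ℤ.*-monoˡ-≤-nonNeg i {{ℤ.nonNegative 0≤i}} 0≤j)

  1≤* : ∀ {i j} → 1ℤ ≤ i → 1ℤ ≤ j → 1ℤ ≤ i * j
  1≤* {i} {j} 1≤i 1≤j = ℤ.≤-trans 1≤j (subst (_≤ i * j) (ℤ.*-identityˡ j)
    (ℤ.*-monoʳ-≤-nonNeg j {{ℤ.nonNegative (ℤ.≤-trans (ℤ.+≤+ z≤n) 1≤j)}} 1≤i))

  0ₛ-nonNegative : NonNegative 0ₛ
  0ₛ-nonNegative _ = ℤ.≤-refl

  1ₛ-nonNegative : NonNegative 1ₛ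
  1ₛ-nonNegative zero    = ℤ.+≤+ z≤n
  1ₛ-nonNegative (suc _) = ℤ.≤-refl

  X-nonNegative : NonNegative X
  X-nonNegative zero    = ℤ.≤-refl
  X-nonNegative (suc n) = 1ₛ-nonNegative n

  ⊕-nonNegative : ∀ {f g} → NonNegative f → NonNegative g → NonNegative (f ⊕ g)
  ⊕-nonNegative 0≤f 0≤g n = ℤ.+-mono-≤ (0≤f n) (0≤g n)

  ⊛-nonNegative : ∀ {f g} → NonNegative f → NonNegative g → NonNegative (f ⊛ g)
  ⊛-nonNegative 0≤f 0≤g zero    = 0≤* (0≤f 0) (0≤g 0)
  ⊛-nonNegative 0≤f 0≤g (suc n) = ℤ.+-mono-≤ (0≤* (0≤f 0) (0≤g (suc n))) (⊛-nonNegative (0≤f ∘ suc) 0≤g n)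

  -- Coefficient i + j of the product contains the summand `f i * g j`, and no other summand is
  -- negative.
  ⊛-positive : ∀ {f g} → NonNegative f → NonNegative g → ∀ i j → 1ℤ ≤ f i → 1ℤ ≤ g j → 1ℤ ≤ (f ⊛ g) (i ℕ.+ j)
  ⊛-positive 0≤f 0≤g zero    zero    1≤f 1≤g = 1≤* 1≤f 1≤g
  ⊛-positive 0≤f 0≤g zero    (suc j) 1≤f 1≤g = ℤ.+-mono-≤ (1≤* 1≤f 1≤g) (⊛-nonNegative (0≤f ∘ suc) 0≤g j)
  ⊛-positive 0≤f 0≤g (suc i) j       1≤f 1≤g =
    ℤ.+-mono-≤ (0≤* (0≤f 0) (0≤g (suc (i ℕ.+ j)))) (⊛-positive (0≤f ∘ suc) 0≤g i j 1≤f 1≤g)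

open PowerSeries

-- Signs of the coefficients of `W`.

module OverpartitionSeries (N : ℕ) where

  open import Data.Integer using (0ℤ; 1ℤ; _*_; _≤_)
  open Algebra.Properties.Semiring.Exp (CommutativeRing.semiring (truncated N)) public
    using () renaming (_^_ to _^ₛ_)

  X^-vanishes : ∀ i n → n ℕ.< i → (X ^ₛ i) n ≡ 0ℤ
  X^-vanishes (suc i) zero    _         = refl
  X^-vanishes (suc i) (suc n) (s≤s n<i) = trans (X⊛-suc (X ^ₛ i) n) (X^-vanishes i n n<i)

  X^-shift-suc : ∀ i f n → (X ^ₛ suc i ⊛ f) (suc n) ≡ (X ^ₛ i ⊛ f) n
  X^-shift-suc i f n = trans (⊛-assoc X (X ^ₛ i) f (suc n)) (X⊛-suc (X ^ₛ i ⊛ f) n)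

  ^-nonNegative : ∀ {f} → NonNegative f → ∀ n → NonNegative (f ^ₛ n)
  ^-nonNegative 0≤f zero    = 1ₛ-nonNegative
  ^-nonNegative 0≤f (suc n) = ⊛-nonNegative 0≤f (^-nonNegative 0≤f n)

  ^-positive : ∀ {f} → NonNegative f → ∀ i → 1ℤ ≤ f i → ∀ n → 1ℤ ≤ (f ^ₛ n) (n ℕ.* i)
  ^-positive 0≤f i 1≤f zero    = ℤ.≤-refl
  ^-positive 0≤f i 1≤f (suc n) = ⊛-positive 0≤f (^-nonNegative 0≤f n) i (n ℕ.* i) 1≤f (^-positive 0≤f i 1≤f n)

  X^-positive : ∀ i → 1ℤ ≤ (X ^ₛ i) i
  X^-positive i = subst (λ n → 1ℤ ≤ (X ^ₛ i) n) (ℕ.*-identityʳ i) (^-positive X-nonNegative 1 ℤ.≤-refl i)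

  open TruncatedTheta (truncated N) using (sum; geometric; module Nilpotent) public
  -- `X^-vanishes N` is literally X^N ≈ 0 in the truncated ring.
  open Nilpotent X N (X^-vanishes N) public

  sum-nonNegative : ∀ n {f} → (∀ m → NonNegative (f m)) → NonNegative (sum n f)
  sum-nonNegative zero    0≤f = 0ₛ-nonNegative
  sum-nonNegative (suc n) 0≤f = ⊕-nonNegative (0≤f 0) (sum-nonNegative n (0≤f ∘ suc))

  geometric-nonNegative : ∀ n {f} → NonNegative f → NonNegative (geometric n f)
  geometric-nonNegative zero    0≤f = 0ₛ-nonNegative
  geometric-nonNegative (suc n) 0≤f =
    ⊕-nonNegative 1ₛ-nonNegative (⊛-nonNegative 0≤f (geometric-nonNegative n 0≤f))

  inv-nonNegative : ∀ s → NonNegative (inv s)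
  inv-nonNegative s = geometric-nonNegative N (^-nonNegative X-nonNegative s)

  P-nonNegative : ∀ m → NonNegative (P m)
  P-nonNegative zero    = 1ₛ-nonNegative
  P-nonNegative (suc m) = ⊕-nonNegative (P-nonNegative m) (⊛-nonNegative (^-nonNegative X-nonNegative (suc m))
    (⊕-nonNegative inv*P inv*P))
    where inv*P = ⊛-nonNegative (inv-nonNegative (suc m)) (P-nonNegative m)

  t-nonNegative : ∀ k m → NonNegative (t k m)
  t-nonNegative k m = ⊛-nonNegative
    (⊛-nonNegative (P-nonNegative m) (^-nonNegative (^-nonNegative X-nonNegative (suc k)) (suc (m ℕ.+ k))))
    (inv-nonNegative (suc (m ℕ.+ k)))

  S-nonNegative : ∀ k → NonNegative (S k)
  S-nonNegative k = sum-nonNegative N (t-nonNegative k)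

  W-nonNegative : ∀ k → NonNegative (W k)
  W-nonNegative k = ⊕-nonNegative P*S P*S
    where P*S = ⊛-nonNegative (P-nonNegative k) (S-nonNegative k)

  geometric-positive : ∀ {f} → NonNegative f → 1ℤ ≤ f 1 → ∀ n m → m ℕ.< n → 1ℤ ≤ geometric n f m
  geometric-positive 0≤f 1≤f (suc n) zero    _         =
    ℤ.+-mono-≤ (ℤ.≤-refl {1ℤ}) (⊛-nonNegative 0≤f (geometric-nonNegative n 0≤f) 0)
  geometric-positive 0≤f 1≤f (suc n) (suc m) (s≤s m<n) =
    ℤ.+-mono-≤ (1ₛ-nonNegative (suc m))
      (⊛-positive 0≤f (geometric-nonNegative n 0≤f) 1 m 1≤f (geometric-positive 0≤f 1≤f n m m<n))

  inv-positive-0 : ∀ s → 0 ℕ.< N → 1ℤ ≤ inv s 0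
  inv-positive-0 s (s≤s {n = n} _) =
    ℤ.+-mono-≤ (ℤ.≤-refl {1ℤ}) (⊛-nonNegative 0≤X^s (geometric-nonNegative n 0≤X^s) 0)
    where 0≤X^s = ^-nonNegative X-nonNegative s

  -- P_1 = (1 + q) / (1 - q) = 1 + 2q + 2q² + ⋯ already has positive coefficients, and later factors
  -- only add nonnegative series. P_0 = 1 does not, hence the index `suc k`.
  P-positive : ∀ k n → n ℕ.< N → 1ℤ ≤ P (suc k) n
  P-positive zero zero    n<N = ℤ.+-mono-≤ (ℤ.≤-refl {1ℤ}) (ℤ.≤-refl {0ℤ})
  P-positive zero (suc n) n<N = ℤ.+-mono-≤ (1ₛ-nonNegative (suc n))
    (⊛-positive (^-nonNegative X-nonNegative 1) (⊕-nonNegative inv*1 inv*1) 1 n ℤ.≤-refl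
      (ℤ.+-mono-≤ (subst (λ i → 1ℤ ≤ (inv 1 ⊛ 1ₛ) i) (ℕ.+-identityʳ n)
              (⊛-positive (inv-nonNegative 1) 1ₛ-nonNegative n 0
                (geometric-positive (^-nonNegative X-nonNegative 1) ℤ.≤-refl N n (ℕ.<-trans (ℕ.n<1+n n) n<N))
                ℤ.≤-refl))
            (inv*1 n)))
    where inv*1 = ⊛-nonNegative (inv-nonNegative 1) 1ₛ-nonNegative
  P-positive (suc k) n n<N = ℤ.+-mono-≤ (P-positive k n n<N) (⊛-nonNegative (^-nonNegative X-nonNegative (2 ℕ.+ k))
    (⊕-nonNegative inv*P inv*P) n)
    where inv*P = ⊛-nonNegative (inv-nonNegative (2 ℕ.+ k)) (P-nonNegative (suc k))

  -- `t k 0` is q^((k+1)²) / (1 - q^(k+1)); its leading coefficient comes from the constant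
  -- coefficient of the inverse.
  t-positive : ∀ k → 0 ℕ.< N → 1ℤ ≤ t k 0 (suc k ℕ.* suc k)
  t-positive k 0<N = subst (λ n → 1ℤ ≤ t k 0 n) (ℕ.+-identityʳ (suc k ℕ.* suc k))
    (⊛-positive (⊛-nonNegative 1ₛ-nonNegative z^) (inv-nonNegative (suc k)) (suc k ℕ.* suc k) 0
      (⊛-positive 1ₛ-nonNegative z^ 0 (suc k ℕ.* suc k) ℤ.≤-refl
        (^-positive (^-nonNegative X-nonNegative (suc k)) (suc k) (X^-positive (suc k)) (suc k)))
      (inv-positive-0 (suc k) 0<N))
    where z^ = ^-nonNegative (^-nonNegative X-nonNegative (suc k)) (suc k)

  S-positive : ∀ k → 0 ℕ.< N → 1ℤ ≤ S k (suc k ℕ.* suc k)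
  S-positive k 0<N@(s≤s {n = n} _) =
    ℤ.+-mono-≤ (t-positive k 0<N) (sum-nonNegative n (t-nonNegative k ∘ suc) (suc k ℕ.* suc k))

  -- Write n = (n - (k+2)²) + (k+2)². The first degree is taken from P_{k+1}, positive throughout
  -- below `N`, the second from S_{k+1}.
  W-positive : ∀ k n → n ℕ.< N → (suc (suc k) ℕ.* suc (suc k)) ℕ.≤ n → 1ℤ ≤ W (suc k) n
  W-positive k n n<N sq≤n =
    ℤ.+-mono-≤ P*S-positive (⊛-nonNegative (P-nonNegative (suc k)) (S-nonNegative (suc k)) n)
    where
    sq = suc (suc k) ℕ.* suc (suc k)
    P*S-positive : 1ℤ ≤ (P (suc k) ⊛ S (suc k)) n
    P*S-positive = subst (λ i → 1ℤ ≤ (P (suc k) ⊛ S (suc k)) i) (ℕ.m∸n+n≡m sq≤n)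
      (⊛-positive (P-nonNegative (suc k)) (S-nonNegative (suc k)) (n ℕ.∸ sq) sq
        (P-positive k (n ℕ.∸ sq) (ℕ.≤-<-trans (ℕ.m∸n≤m n sq) n<N))
        (S-positive (suc k) (ℕ.≤-<-trans z≤n n<N)))

-- Enumeration of overpartitions by largest part.

module Enumeration where

  open import Data.Integer using (+_)

  AtMost : ℕ → List Part → Set
  AtMost s = All (λ p → size p ℕ.≤ s)

  -- What `firstOnly` demands of a list when a part of size s is put in front of it.
  NotOverlined : ℕ → List Part → Set
  NotOverlined s = All (λ p → T (overlined p) → s ≢ size p)

  cons⁺ : ∀ {s b n ps} → 1 ℕ.≤ s → IsOverpartition n ps → AtMost s ps → NotOverlined s ps →
    IsOverpartition (s ℕ.+ n) (part s b ∷ ps)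
  cons⁺ {s} 1≤s (isOverpartition pos lnk fst refl) ≤s plain =
    isOverpartition (1≤s ∷ pos) (linked ≤s lnk) (plain ∷ fst) refl
    where
    linked : ∀ {ps} → AtMost s ps → Linked _≥_ (map size ps) → Linked _≥_ (s ∷ map size ps)
    linked []        []  = [-]
    linked (p≤s ∷ _) lnk = p≤s ∷ lnk

  cons⁻ : ∀ {n p ps} → IsOverpartition n (p ∷ ps) →
    1 ℕ.≤ size p × AtMost (size p) ps × NotOverlined (size p) ps ×
    ∃ λ n′ → n ≡ size p ℕ.+ n′ × IsOverpartition n′ ps
  cons⁻ (isOverpartition (1≤p ∷ pos) lnk (plain ∷ fst) refl)
    with Linked⇒AllPairs (λ i≥j j≥k → ℕ.≤-trans j≥k i≥j) lnk
  ... | ≤p ∷ _ = 1≤p , All.map⁻ ≤p , plain , _ , refl , isOverpartition pos (tail lnk) fst refl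
    where
    tail : ∀ {x xs} → Linked _≥_ (x ∷ xs) → Linked _≥_ xs
    tail [-]       = []
    tail (_ ∷ lnk) = lnk

  atMost-pred : ∀ {m n p ps} → IsOverpartition n (p ∷ ps) → size p ℕ.≤ suc m → size p ≢ suc m → AtMost m (p ∷ ps)
  atMost-pred op p≤1+m p≢1+m = p≤m ∷ All.map (λ q≤p → ℕ.≤-trans q≤p p≤m) (proj₁ (proj₂ (cons⁻ op)))
    where p≤m = ℕ.s≤s⁻¹ (ℕ.≤∧≢⇒< p≤1+m p≢1+m)

  -- The counterpart on families of lists of multiplication by q^s.
  shift : ∀ {A : Set} → ℕ → (ℕ → List A) → ℕ → List A
  shift zero    F n       = F n
  shift (suc s) F zero    = []
  shift (suc s) F (suc n) = shift s F n

  ∈-shift⁺ : ∀ {A : Set} s (F : ℕ → List A) {n x} → x ∈ F n → x ∈ shift s F (s ℕ.+ n)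
  ∈-shift⁺ zero    F x∈ = x∈
  ∈-shift⁺ (suc s) F x∈ = ∈-shift⁺ s F x∈

  ∈-shift⁻ : ∀ {A : Set} s (F : ℕ → List A) {n x} → x ∈ shift s F n → ∃ λ n′ → n ≡ s ℕ.+ n′ × x ∈ F n′
  ∈-shift⁻ zero    F {n}     x∈ = n , refl , x∈
  ∈-shift⁻ (suc s) F {suc n} x∈ with ∈-shift⁻ s F x∈
  ... | n′ , eq , x∈′ = n′ , cong suc eq , x∈′

  shift-unique : ∀ {A : Set} s {F : ℕ → List A} → (∀ n → Unique (F n)) → ∀ n → Unique (shift s F n)
  shift-unique zero    u n       = u n
  shift-unique (suc s) u zero    = []
  shift-unique (suc s) u (suc n) = shift-unique s u n

  -- Fewer than l copies of the part s, none overlined, in front of a list from F.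
  copies : ℕ → ℕ → (ℕ → List (List Part)) → ℕ → List (List Part)
  copies s zero    F n = []
  copies s (suc l) F n = F n ++ shift s (λ n′ → map (part s false ∷_) (copies s l F n′)) n

  -- Adds the first occurrence of s, the only one that may be overlined; the further occurrences
  -- come from `copies`. This is the 2 in 1 + 2 q^s / (1 - q^s).
  both : ℕ → List (List Part) → List (List Part)
  both s pss = map (part s false ∷_) pss ++ map (part s true ∷_) pss

  -- The overpartitions of n into parts of size at most m; all of them only when n < l.
  bounded : ℕ → ℕ → ℕ → List (List Part)
  bounded l zero    zero    = [] ∷ []
  bounded l zero    (suc n) = []
  bounded l (suc m) n       = bounded l m n ++
    shift (suc m) (λ n′ → both (suc m) (copies (suc m) l (bounded l m) n′)) n

  both⁻ : ∀ s pss {ps} → ps ∈ both s pss → ∃ λ b → ∃ λ ps′ → ps ≡ part s b ∷ ps′ × ps′ ∈ pss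
  both⁻ s pss ps∈ with ∈-++⁻ (map (part s false ∷_) pss) ps∈
  ... | inj₁ ps∈₁ with ∈-map⁻ _ ps∈₁
  ...   | ps′ , ps′∈ , refl = false , ps′ , refl , ps′∈
  both⁻ s pss ps∈ | inj₂ ps∈₂ with ∈-map⁻ _ ps∈₂
  ...   | ps′ , ps′∈ , refl = true , ps′ , refl , ps′∈

  both⁺ : ∀ s b pss {ps} → ps ∈ pss → part s b ∷ ps ∈ both s pss
  both⁺ s false pss ps∈ = ∈-++⁺ˡ (∈-map⁺ _ ps∈)
  both⁺ s true  pss ps∈ = ∈-++⁺ʳ (map (part s false ∷_) pss) (∈-map⁺ _ ps∈)

  both-unique : ∀ s {pss} → Unique pss → Unique (both s pss)
  both-unique s {pss} u = Unique.++⁺ (Unique.map⁺ ∷-injectiveʳ u) (Unique.map⁺ ∷-injectiveʳ u) disjoint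
    where
    disjoint : Disjoint (map (part s false ∷_) pss) (map (part s true ∷_) pss)
    disjoint (f∈ , t∈) with ∈-map⁻ _ f∈ | ∈-map⁻ _ t∈
    ... | _ , _ , refl | _ , _ , ()

  module Copies (m : ℕ) (F : ℕ → List (List Part))
    (F-sound : ∀ {n ps} → ps ∈ F n → IsOverpartition n ps × AtMost m ps) where

    sound : ∀ l {n ps} → ps ∈ copies (suc m) l F n →
      IsOverpartition n ps × AtMost (suc m) ps × NotOverlined (suc m) ps
    sound (suc l) {n} ps∈ with ∈-++⁻ (F n) ps∈
    ... | inj₁ ps∈F with F-sound ps∈F
    ...   | op , ≤m = op , All.map ℕ.m≤n⇒m≤1+n ≤m , All.map (λ p≤m _ 1+m≡p → ℕ.<⇒≢ (s≤s p≤m) (sym 1+m≡p)) ≤m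
    sound (suc l) {n} ps∈ | inj₂ ps∈s with ∈-shift⁻ (suc m) _ {n} ps∈s
    ...   | _ , refl , ps∈c with ∈-map⁻ _ ps∈c
    ...     | ps′ , ps′∈ , refl with sound l ps′∈
    ...       | op , ≤1+m , plain = cons⁺ (s≤s z≤n) op ≤1+m plain , ℕ.≤-refl ∷ ≤1+m , (λ ()) ∷ plain

    -- Each copy of the part lowers n by at least one, so fewer than l copies suffice when n < l.
    -- The range L in which F is complete is separate because it stays fixed while l decreases.
    complete : ∀ {L} → (∀ {n ps} → n ℕ.< L → IsOverpartition n ps → AtMost m ps → ps ∈ F n) →
      ∀ l {n ps} → n ℕ.< l → n ℕ.< L → IsOverpartition n ps → AtMost (suc m) ps → NotOverlined (suc m) ps →
      ps ∈ copies (suc m) l F n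
    complete F-complete (suc l) {ps = []} _ n<L op _ _ = ∈-++⁺ˡ (F-complete n<L op [])
    complete F-complete (suc l) {n} {p ∷ ps} (s≤s n≤l) n<L op (p≤ ∷ _) (plain ∷ _) with size p ℕ.≟ suc m
    ... | no p≢ = ∈-++⁺ˡ (F-complete n<L op (atMost-pred op p≤ p≢))
    complete F-complete (suc l) {n} {part _ true ∷ _} _ _ _ _ (plain ∷ _) | yes refl = ⊥-elim (plain tt refl)
    complete F-complete (suc l) {n} {part _ false ∷ _} (s≤s n≤l) n<L op _ _ | yes refl with cons⁻ op
    ... | _ , ≤p , plain , n′ , refl , op′ = ∈-++⁺ʳ (F n) (∈-shift⁺ (suc m) _ (∈-map⁺ (part (suc m) false ∷_)
      (complete F-complete l (ℕ.<-≤-trans n′< n≤l) (ℕ.<-trans n′< n<L) op′ ≤p plain)))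
      where
      n′< : n′ ℕ.< n
      n′< = s≤s (ℕ.m≤n+m n′ m)

    -- All parts of a list in F are at most m, so none can begin with m + 1.
    disjoint : ∀ {n F′} → (∀ {ps} → ps ∈ F′ → ∃ λ b → ∃ λ ps′ → ps ≡ part (suc m) b ∷ ps′) → Disjoint (F n) F′
    disjoint heads (ps∈ , ps∈′) with heads ps∈′
    ... | _ , _ , refl with F-sound ps∈
    ...   | _ , 1+m≤m ∷ _ = ℕ.1+n≰n 1+m≤m

    unique : (∀ n → Unique (F n)) → ∀ l n → Unique (copies (suc m) l F n)
    unique u zero    n = []
    unique u (suc l) n = Unique.++⁺ (u n)
      (shift-unique (suc m) (λ n′ → Unique.map⁺ ∷-injectiveʳ (unique u l n′)) n) (disjoint heads)
      where
      heads : ∀ {ps} → ps ∈ shift (suc m) (λ n′ → map (part (suc m) false ∷_) (copies (suc m) l F n′)) n → _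
      heads ps∈ with ∈-shift⁻ (suc m) _ {n} ps∈
      ... | _ , _ , ps∈c with ∈-map⁻ _ ps∈c
      ...   | ps′ , _ , refl = false , ps′ , refl

  bounded-sound : ∀ l m {n ps} → ps ∈ bounded l m n → IsOverpartition n ps × AtMost m ps
  bounded-sound l zero {zero} (here refl) = isOverpartition [] [] [] refl , []
  bounded-sound l (suc m) {n} ps∈ with ∈-++⁻ (bounded l m n) ps∈
  ... | inj₁ ps∈b with bounded-sound l m ps∈b
  ...   | op , ≤m = op , All.map ℕ.m≤n⇒m≤1+n ≤m
  bounded-sound l (suc m) {n} ps∈ | inj₂ ps∈s with ∈-shift⁻ (suc m) _ {n} ps∈s
  ...   | n′ , refl , ps∈c with both⁻ (suc m) (copies (suc m) l (bounded l m) n′) ps∈c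
  ...     | _ , _ , refl , ps′∈ with Copies.sound m (bounded l m) (bounded-sound l m) l ps′∈
  ...       | op , ≤1+m , plain = cons⁺ (s≤s z≤n) op ≤1+m plain , ℕ.≤-refl ∷ ≤1+m

  bounded-complete : ∀ l m {n ps} → n ℕ.< l → IsOverpartition n ps → AtMost m ps → ps ∈ bounded l m n
  bounded-complete l zero    {ps = []} _ (isOverpartition _ _ _ refl) _ = here refl
  bounded-complete l zero    {ps = p ∷ ps} _ (isOverpartition (1≤p ∷ _) _ _ _) (p≤0 ∷ _) = ⊥-elim (ℕ.<⇒≱ 1≤p p≤0)
  bounded-complete l (suc m) {ps = []} n<l op _ = ∈-++⁺ˡ (bounded-complete l m n<l op [])
  bounded-complete l (suc m) {n} {p ∷ ps} n<l op (p≤ ∷ _) with size p ℕ.≟ suc m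
  ... | no p≢ = ∈-++⁺ˡ (bounded-complete l m n<l op (atMost-pred op p≤ p≢))
  bounded-complete l (suc m) {n} {part _ b ∷ ps} n<l op _ | yes refl with cons⁻ op
  ... | _ , ≤p , plain , n′ , refl , op′ = ∈-++⁺ʳ (bounded l m n) (∈-shift⁺ (suc m) _
    (both⁺ (suc m) b (copies (suc m) l (bounded l m) n′)
      (Copies.complete m (bounded l m) (bounded-sound l m) (bounded-complete l m) l n′<l n′<l op′ ≤p plain)))
    where
    n′<l : n′ ℕ.< l
    n′<l = ℕ.≤-<-trans (ℕ.m≤n+m n′ (suc m)) n<l

  bounded-unique : ∀ l m n → Unique (bounded l m n)
  bounded-unique l zero    zero    = [] ∷ []
  bounded-unique l zero    (suc n) = []
  bounded-unique l (suc m) n = Unique.++⁺ (bounded-unique l m n)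
    (shift-unique (suc m) (λ n′ → both-unique (suc m) (C.unique (bounded-unique l m) l n′)) n) (C.disjoint heads)
    where
    module C = Copies m (bounded l m) (bounded-sound l m)
    heads : ∀ {ps} → ps ∈ shift (suc m) (λ n′ → both (suc m) (copies (suc m) l (bounded l m) n′)) n → _
    heads ps∈ with ∈-shift⁻ (suc m) _ {n} ps∈
    ... | n′ , _ , ps∈c with both⁻ (suc m) (copies (suc m) l (bounded l m) n′) ps∈c
    ...   | b , ps′ , refl , _ = b , ps′ , refl

  -- Two duplicate-free lists with the same elements are permutations of each other. The bound l on
  -- the parts excludes nothing, since every part is at most n < l.
  length-bounded : ∀ l n → n ℕ.< l → length (bounded l l n) ≡ length (overpartitions n)
  length-bounded l n n<l =
    ↭-length (∼bag⇒↭ (unique∧set⇒bag (bounded-unique l l n) (overpartitions-unique n) (mk⇔ to from)))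
    where
    to : ∀ {ps} → ps ∈ bounded l l n → ps ∈ overpartitions n
    to ps∈ = Equivalence.from (overpartitions-complete n _) (proj₁ (bounded-sound l l ps∈))
    from : ∀ {ps} → ps ∈ overpartitions n → ps ∈ bounded l l n
    from {ps} ps∈ with Equivalence.to (overpartitions-complete n ps) ps∈
    ... | op@(isOverpartition _ _ _ refl) =
      bounded-complete l l n<l op (All.map (λ p≤n → ℕ.≤-trans p≤n (ℕ.<⇒≤ n<l)) (sizes≤sum ps))

  count : ∀ {A : Set} → (ℕ → List A) → Series
  count F n = + length (F n)

  count-++ : ∀ {A : Set} (xs ys : List A) → + length (xs ++ ys) ≡ + length xs ℤ.+ + length ys
  count-++ xs ys = cong +_ (length-++ xs)

open Enumeration

-- The generating function of overpartitions.

module CountBounded (N : ℕ) where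

  open import Data.Integer using (+_)
  open OverpartitionSeries N

  count-shift : ∀ {A : Set} s (F : ℕ → List A) n → count (shift s F) n ≡ (X ^ₛ s ⊛ count F) n
  count-shift zero    F n       = sym (⊛-identityˡ (count F) n)
  count-shift (suc s) F zero    = refl
  count-shift (suc s) F (suc n) = trans (count-shift s F n) (sym (X^-shift-suc s (count F) n))

  -- `copies` and `geometric` have the same recursion: prepending a part s multiplies by q^s, and
  -- concatenation adds.
  count-copies : ∀ s l F n → count (copies s l F) n ≡ (geometric l (X ^ₛ s) ⊛ count F) n
  count-copies s zero    F n = sym (⊛-zeroˡ (count F) n)
  count-copies s (suc l) F n = begin
    + length (F n ++ shift s F′ n)
      ≡⟨ count-++ (F n) (shift s F′ n) ⟩
    count F n ℤ.+ count (shift s F′) n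
      ≡⟨ cong (ℤ._+_ (count F n)) (count-shift s F′ n) ⟩
    count F n ℤ.+ (X ^ₛ s ⊛ count F′) n
      ≡⟨ cong (ℤ._+_ (count F n)) (⊛-cong n {f = X ^ₛ s} (λ _ → refl) (λ {m} _ → count-F′ m)) ⟩
    count F n ℤ.+ (X ^ₛ s ⊛ (g ⊛ count F)) n
      ≡⟨ cong₂ ℤ._+_ (⊛-identityˡ (count F) n) (⊛-assoc (X ^ₛ s) g (count F) n) ⟨
    (1ₛ ⊛ count F) n ℤ.+ (X ^ₛ s ⊛ g ⊛ count F) n
      ≡⟨ ⊛-distribʳ (count F) 1ₛ (X ^ₛ s ⊛ g) n ⟨
    ((1ₛ ⊕ X ^ₛ s ⊛ g) ⊛ count F) n ∎
    where
    open ≡-Reasoning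
    F′ : ℕ → List (List Part)
    F′ n′ = map (part s false ∷_) (copies s l F n′)
    g = geometric l (X ^ₛ s)
    count-F′ : ∀ m → count F′ m ≡ (g ⊛ count F) m
    count-F′ m = trans (cong +_ (length-map (part s false ∷_) (copies s l F m))) (count-copies s l F m)

  -- Taking `N` as the limit on copies matches the truncated geometric sum in `inv`, so equality
  -- holds in every degree, even where the enumeration is incomplete.
  count-bounded : ∀ m n → count (bounded N m) n ≡ P m n
  count-bounded zero    zero    = refl
  count-bounded zero    (suc n) = refl
  count-bounded (suc m) n = begin
    + length (bounded N m n ++ shift (suc m) F′ n)
      ≡⟨ count-++ (bounded N m n) (shift (suc m) F′ n) ⟩
    count (bounded N m) n ℤ.+ count (shift (suc m) F′) n
      ≡⟨ cong₂ ℤ._+_ (count-bounded m n) (count-shift (suc m) F′ n) ⟩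
    P m n ℤ.+ (X ^ₛ suc m ⊛ count F′) n
      ≡⟨ cong (ℤ._+_ (P m n)) (⊛-cong n {f = X ^ₛ suc m} (λ _ → refl) (λ {i} _ → count-F′ i)) ⟩
    P (suc m) n ∎
    where
    open ≡-Reasoning
    C F′ : ℕ → List (List Part)
    C = copies (suc m) N (bounded N m)
    F′ n′ = both (suc m) (C n′)
    count-C : ∀ i b → + length (map (part (suc m) b ∷_) (C i)) ≡ (inv (suc m) ⊛ P m) i
    count-C i b = trans (cong +_ (length-map (part (suc m) b ∷_) (C i)))
      (trans (count-copies (suc m) N (bounded N m) i)
        (⊛-cong i {f = inv (suc m)} (λ _ → refl) (λ {j} _ → count-bounded m j)))
    count-F′ : ∀ i → count F′ i ≡ (inv (suc m) ⊛ P m ⊕ inv (suc m) ⊛ P m) i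
    count-F′ i = trans (count-++ (map (part (suc m) false ∷_) (C i)) (map (part (suc m) true ∷_) (C i)))
      (cong₂ ℤ._+_ (count-C i false) (count-C i true))

  P-overpartitions : ∀ n → n ℕ.< N → P N n ≡ p̄ (+ n)
  P-overpartitions n n<N = trans (sym (count-bounded N n)) (cong +_ (length-bounded N n n<N))

  p̄-shift : ∀ i n → n ℕ.< N → (X ^ₛ i ⊛ P N) n ≡ p̄ (+ n ℤ.- + i)
  p̄-shift i n n<N = trans
    (⊛-cong n {f = X ^ₛ i} (λ _ → refl) (λ {m} m≤n → P-overpartitions m (ℕ.≤-<-trans m≤n n<N)))
    (trans (go i n) (cong p̄ (sym (ℤ.m-n≡m⊖n n i))))
    where
    p̄₊ : Series
    p̄₊ m = p̄ (+ m)
    go : ∀ i n → (X ^ₛ i ⊛ p̄₊) n ≡ p̄ (n ℤ.⊖ i)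
    go zero    n       = ⊛-identityˡ p̄₊ n
    -- Below degree i the product vanishes, in accordance with the value 0 of `p̄` at negative
    -- integers.
    go (suc i) zero    = refl
    go (suc i) (suc n) = trans (X^-shift-suc i p̄₊ n) (trans (go i n) (cong p̄ (sym (ℤ.[1+m]⊖[1+n]≡m⊖n n i))))

-- The signed truncated sums as coefficients of `W`.

open import Data.Integer using (ℤ; +_; -1ℤ; 0ℤ; 1ℤ; _+_; _-_; _*_; _^_; _≤_; _<_)

-1^-square : ∀ k → -1ℤ ^ k * -1ℤ ^ k ≡ 1ℤ
-1^-square zero    = refl
-1^-square (suc k) = trans (solve 1 (λ e → con -1ℤ :* e :* (con -1ℤ :* e) := e :* e) refl (-1ℤ ^ k)) (-1^-square k)
  where
  open +-*-Solver

thetaTerm : ℕ → ℕ → ℤ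
thetaTerm n j = -1ℤ ^ j * p̄ (+ n - + (j ℕ.^ 2))

truncatedTheta : ℕ → ℕ → ℤ
truncatedTheta n k = -1ℤ ^ k * (p̄ (+ n) + + 2 * ∑₁ k (thetaTerm n))

module _ (m : ℕ) where
  private
    n = suc m
    n<N : n ℕ.< suc n
    n<N = ℕ.n<1+n n
  -- Truncation at `suc n` is the least one that retains the coefficient of q^n.
  open OverpartitionSeries (suc n)
  open CountBounded (suc n)

  -- Both sides satisfy the same recursion in k: the values at k and k + 1 add up to 2 p̄(n -
  -- (k+1)²). The constant 1 in `W-zero` is invisible because n ≥ 1.
  truncatedTheta≡W : ∀ k → truncatedTheta n k ≡ W k n
  truncatedTheta≡W zero = begin
    1ℤ * (p̄ (+ n) + + 2 * 0ℤ)  ≡⟨ solve 1 (λ p → con 1ℤ :* (p :+ con (+ 2) :* con 0ℤ) := p) refl (p̄ (+ n)) ⟩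
    p̄ (+ n)                    ≡⟨ P-overpartitions n n<N ⟨
    P (suc n) n                ≡⟨ W-zero n n<N ⟨
    W 0 n + 0ℤ                 ≡⟨ ℤ.+-identityʳ (W 0 n) ⟩
    W 0 n                      ∎
    where
    open ≡-Reasoning
    open +-*-Solver
  truncatedTheta≡W (suc k) = begin
    -1ℤ * e * (p + + 2 * (s + -1ℤ * e * c))
      -- The new summand carries the sign twice, as `e * e`, which is 1; the earlier ones change
      -- sign and form minus the previous value.
      ≡⟨ solve 4 (λ e p s c → con -1ℤ :* e :* (p :+ con (+ 2) :* (s :+ con -1ℤ :* e :* c))
           := (e :* e) :* (c :+ c) :- e :* (p :+ con (+ 2) :* s)) refl e p s c ⟩
    e * e * (c + c) - truncatedTheta n k
      ≡⟨ cong₂ (λ i j → i * (c + c) - j) (-1^-square k) (truncatedTheta≡W k) ⟩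
    1ℤ * (c + c) - W k n
      ≡⟨ cong (λ i → 1ℤ * i - W k n) step ⟨
    1ℤ * (W (suc k) n + W k n) - W k n
      ≡⟨ solve 2 (λ w′ w → con 1ℤ :* (w′ :+ w) :- w := w′) refl (W (suc k) n) (W k n) ⟩
    W (suc k) n ∎
    where
    open ≡-Reasoning
    open +-*-Solver
    e = -1ℤ ^ k
    p = p̄ (+ n)
    s = ∑₁ k (thetaTerm n)
    c = p̄ (+ n - + (suc k ℕ.^ 2))
    step : W (suc k) n + W k n ≡ c + c
    step = trans (W-suc k n n<N) (cong (λ i → i + i) (p̄-shift (suc k ℕ.^ 2) n n<N))

  truncatedTheta-nonNegative : ∀ k → 0ℤ ≤ truncatedTheta n k
  truncatedTheta-nonNegative k = subst (0ℤ ≤_) (sym (truncatedTheta≡W k)) (W-nonNegative k n)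

  truncatedTheta-positive : ∀ k → suc (suc k) ℕ.^ 2 ℕ.≤ n → 0ℤ < truncatedTheta n (suc k)
  truncatedTheta-positive k sq≤n = subst (0ℤ <_) (sym (truncatedTheta≡W (suc k)))
    (ℤ.<-≤-trans (ℤ.+<+ (s≤s z≤n)) (W-positive k n n<N
      (subst (λ i → suc (suc k) ℕ.* i ℕ.≤ n) (ℕ.*-identityʳ (suc (suc k))) sq≤n)))

corollary1p2 : ((n k : ℕ) → n ℕ.≥ 1 → k ℕ.≥ 1 →
    let S = -1ℤ ^ k * (p̄ (+ n) + + 2 * ∑₁ k (λ j → -1ℤ ^ j * p̄ (+ n - + (j ℕ.^ 2)))) in
    (0ℤ ≤ S) × (n ℕ.≥ (k ℕ.+ 1) ℕ.^ 2 → 0ℤ < S))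
    × ((n : ℕ) → n ℕ.≥ 1 →
    (p̄ (+ n) - + 2 * p̄ (+ n - + 1) ≤ 0ℤ)
    × (0ℤ ≤ p̄ (+ n) - + 2 * p̄ (+ n - + 1) + + 2 * p̄ (+ n - + 4))
    × (p̄ (+ n) - + 2 * p̄ (+ n - + 1) + + 2 * p̄ (+ n - + 4) - + 2 * p̄ (+ n - + 9) ≤ 0ℤ))
corollary1p2 = general , λ { (suc m) _ → first m , second m , third m }
  where
  open +-*-Solver
  general : (n k : ℕ) → n ℕ.≥ 1 → k ℕ.≥ 1 →
    (0ℤ ≤ truncatedTheta n k) × (n ℕ.≥ (k ℕ.+ 1) ℕ.^ 2 → 0ℤ < truncatedTheta n k)
  general (suc m) (suc k) _ _ = truncatedTheta-nonNegative m (suc k) ,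
    λ sq≤n → truncatedTheta-positive m k (subst (λ i → i ℕ.^ 2 ℕ.≤ suc m) (ℕ.+-comm (suc k) 1) sq≤n)

  module _ (m : ℕ) where
    private
      n = suc m
      p = p̄ (+ n)
      a = p̄ (+ n - + 1)
      b = p̄ (+ n - + 4)
      c = p̄ (+ n - + 9)

    first : p - + 2 * a ≤ 0ℤ
    -- The three examples are k = 1, 2, 3; for odd k the factor (-1)^k negates the sum, so the
    -- inequality is reversed.
    first = ℤ.neg-cancel-≤ (subst (0ℤ ≤_)
      (solve 2 (λ p a → con -1ℤ :* (p :+ con (+ 2) :* (con 0ℤ :+ con -1ℤ :* a))
        := :- (p :- con (+ 2) :* a)) refl p a)
      (truncatedTheta-nonNegative m 1))

    second : 0ℤ ≤ p - + 2 * a + + 2 * b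
    second = subst (0ℤ ≤_)
      (solve 3 (λ p a b → con 1ℤ :* (p :+ con (+ 2) :* (con 0ℤ :+ con -1ℤ :* a :+ con 1ℤ :* b))
        := p :- con (+ 2) :* a :+ con (+ 2) :* b) refl p a b)
      (truncatedTheta-nonNegative m 2)

    third : p - + 2 * a + + 2 * b - + 2 * c ≤ 0ℤ
    third = ℤ.neg-cancel-≤ (subst (0ℤ ≤_)
      (solve 4 (λ p a b c → con -1ℤ :* (p :+ con (+ 2) :* (con 0ℤ :+ con -1ℤ :* a :+ con 1ℤ :* b :+ con -1ℤ :* c))
        := :- (p :- con (+ 2) :* a :+ con (+ 2) :* b :- con (+ 2) :* c)) refl p a b c)
      (truncatedTheta-nonNegative m 3))
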